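{- Let $H$ be a Hadamard matrix of order $n$, and for $m\in\{2,3\}$ let $Z(m,H)$ be the number of zero minors of order $m$ of $H$. Then $$Z(2,H) = \frac{n^2(n-1)(n-2)}{8}$$ and $$Z(3,H) = \frac{n^2(n-1)(n-2)(n-4)(5n-4)}{288}.$$
   Context: A Hadamard matrix of order $n$ is an $n\times n$ matrix $H$ with entries in $\{+1,-1\}$ satisfying $HH^T = nI$. A minor of order $m$ of $H$ is the determinant of an $m\times m$ submatrix of $H$, obtained by choosing $m$ of the rows and $m$ of the columns of $H$ (not necessarily consecutive). Minors are counted by the choice of rows and columns, so there are $\binom{n}{m}^2$ minors of order $m$ in total (in particular none if $m>n$). -}

module Defs where

open import Data.Bool.Base using (if_then_else_)
open import Data.Fin.Base using (Fin; zero; suc; toℕ)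
open import Data.Fin.Properties using (_≟_)
open import Data.Integer.Base using (ℤ; +_; 0ℤ; 1ℤ; -1ℤ; _*_; _^_)
import Data.Integer.Properties as ℤ
open import Algebra.Properties.Semiring.Sum ℤ.+-*-semiring using (sum)
open import Data.List.Base as List
  using (List; []; _∷_; _++_; length; filter; cartesianProductWith)
open import Data.Nat.Base using (ℕ; zero; suc)
open import Data.Sum.Base using (_⊎_)
open import Data.Vec.Base as Vec using (Vec; []; _∷_; lookup)
open import Data.Vec.Functional using (Vector; transpose; removeAt)
open import Relation.Binary.PropositionalEquality.Core using (_≡_)
open import Relation.Nullary.Decidable.Core using (does)

Matrix : ℕ → ℕ → Set
Matrix m n = Vector (Vector ℤ n) m

infixl 7 _⊗_ _•_

_⊗_ : ∀ {k m n} → Matrix k m → Matrix m n → Matrix k n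
(A ⊗ B) i j = sum (λ k → A i k * B k j)

_•_ : ∀ {m n} → ℤ → Matrix m n → Matrix m n
(c • A) i j = c * A i j

𝕀 : ∀ n → Matrix n n
𝕀 n i j = if does (i ≟ j) then 1ℤ else 0ℤ

record IsHadamard {n : ℕ} (H : Matrix n n) : Set where
  field
    entries    : ∀ i j → H i j ≡ 1ℤ ⊎ H i j ≡ -1ℤ
    orthogonal : ∀ i j → (H ⊗ transpose H) i j ≡ ((+ n) • 𝕀 n) i j

-- Laplace expansion along the first row.
det : ∀ {n} → Matrix n n → ℤ
det {zero}  A = 1ℤ
det {suc n} A = sum λ j →
  -1ℤ ^ toℕ j * A zero j * det (λ i → removeAt (A (suc i)) j)

-- Each m-element subset of Fin n exactly once, as the strictly increasing
-- vector of its elements: first the subsets containing zero, then the others.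
choices : ∀ m n → List (Vec (Fin n) m)
choices zero    n       = [] ∷ []
choices (suc m) zero    = []
choices (suc m) (suc n) =
  List.map (λ v → zero ∷ Vec.map suc v) (choices m n) ++
  List.map (Vec.map suc) (choices (suc m) n)

submatrix : ∀ {k l m n} → Matrix m n → Vec (Fin m) k → Vec (Fin n) l → Matrix k l
submatrix A rows cols i j = A (lookup rows i) (lookup cols j)

-- One entry for each choice of rows and columns, so values may repeat.
minors : ∀ m {n} → Matrix n n → List ℤ
minors m {n} H =
  cartesianProductWith (λ rows cols → det (submatrix H rows cols))
    (choices m n) (choices m n)

Z : ∀ m {n} → Matrix n n → ℕ
Z m H = length (filter (ℤ._≟ 0ℤ) (minors m H))

{-# OPTIONS --safe #-}
-- A 2 × 2 minor of a ±1 matrix is 0 or ±2 and a 3 × 3 minor is 0 or ±4, so the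
-- non-zero minors are counted by the sum of the squares of all minors.  For a
-- fixed set of m rows, Cauchy–Binet equates the sum over all column choices
-- with the Gram determinant of these rows, which is n ^ m by orthogonality.
module Submission where

open import Defs
open import Data.Nat.Base using (ℕ)
open import Data.Integer.Base using (+_; _-_; _*_; _^_)
open import Data.Rational.Base using (_/_)
open import Data.Product.Base using (_×_)
open import Relation.Binary.PropositionalEquality.Core using (_≡_)

open import Data.Fin.Base using (Fin; zero; suc)
open import Data.Fin.Patterns using (0F; 1F; 2F)
import Data.Fin.Properties as Fin
open import Data.Integer.Base using (ℤ; 0ℤ; 1ℤ; -1ℤ; _+_)
import Data.Integer.Properties as ℤ
open import Algebra.Properties.Semiring.Sum ℤ.+-*-semiring using (sum; sum-cong-≗)
open import Data.Integer.Tactic.RingSolver using (solve-∀)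
open import Data.List.Base as List
  using (List; []; _∷_; _++_; length; filter; cartesianProductWith)
open import Data.List.Relation.Unary.All as All using (All; []; _∷_)
open import Data.List.Relation.Unary.All.Properties as All
  using (++⁺; map⁺; cartesianProductWith⁺)
open import Data.Nat.Base using (zero; suc)
open import Data.Product.Base using (_,_)
open import Data.Rational.Properties using (fromℚᵘ-cong)
open import Data.Rational.Unnormalised.Base using (mkℚᵘ; *≡*)
open import Data.Sum.Base using (_⊎_; inj₁; inj₂)
open import Data.Vec.Base as Vec using (Vec; []; _∷_)
open import Data.Vec.Relation.Unary.All as VecAll using ([]; _∷_)
import Data.Vec.Relation.Unary.All.Properties as VecAll
open import Data.Vec.Relation.Unary.AllPairs using ([]; _∷_)
open import Data.Vec.Relation.Unary.Unique.Propositional using (Unique)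
import Data.Vec.Relation.Unary.Unique.Propositional.Properties as Unique
open import Data.Vec.Functional using (Vector; removeAt)
open import Function.Base using (_∘_; const)
open import Relation.Binary.PropositionalEquality
  using (_≢_; refl; sym; trans; cong; cong₂; subst; setoid; module ≡-Reasoning)
open import Relation.Nullary using (Dec; yes; no; contradiction)
open import Relation.Nullary.Decidable using (map′; _×-dec_; _⊎-dec_; toWitness)
open import Relation.Unary using (Decidable)

open ≡-Reasoning

private variable
  A B : Set
  n : ℕ

-- Sums over lists

total : (A → ℤ) → List A → ℤ
total f []       = 0ℤ
total f (x ∷ xs) = f x + total f xs

total-cong : {f g : A → ℤ} → (∀ x → f x ≡ g x) → ∀ xs → total f xs ≡ total g xs
total-cong f≗g []       = refl
total-cong f≗g (x ∷ xs) = cong₂ _+_ (f≗g x) (total-cong f≗g xs)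

total-++ : (f : A → ℤ) → ∀ xs ys → total f (xs ++ ys) ≡ total f xs + total f ys
total-++ f []       ys = sym (ℤ.+-identityˡ _)
total-++ f (x ∷ xs) ys =
  trans (cong (λ y → f x + y) (total-++ f xs ys)) (sym (ℤ.+-assoc (f x) _ _))

total-map : (g : B → ℤ) (f : A → B) → ∀ xs → total g (List.map f xs) ≡ total (g ∘ f) xs
total-map g f []       = refl
total-map g f (x ∷ xs) = cong (λ y → g (f x) + y) (total-map g f xs)

-- Serves two counts of minors. With `g` the square, `c` is the value that Cauchy-Binet gives for
-- every row choice; with `g` constantly 1, `c` is the number of column choices. The hypothesis is
-- an `All` over `xs` because that value is available only for rows that are distinct.
total-cartesianProductWith :
  ∀ {C : Set} (g : C → ℤ) (f : A → B → C) ys c {xs} →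
  All (λ x → total (g ∘ f x) ys ≡ c) xs →
  total g (cartesianProductWith f xs ys) ≡ total (const 1ℤ) xs * c
total-cartesianProductWith g f ys c []                      = refl
total-cartesianProductWith g f ys c {x ∷ xs} (eq ∷ eqs) = begin
  total g (List.map (f x) ys ++ cartesianProductWith f xs ys)
    ≡⟨ total-++ g (List.map (f x) ys) _ ⟩
  total g (List.map (f x) ys) + total g (cartesianProductWith f xs ys)
    ≡⟨ cong₂ _+_ (trans (total-map g (f x) ys) eq)
                 (total-cartesianProductWith g f ys c eqs) ⟩
  c + total (const 1ℤ) xs * c
    ≡⟨ step c (total (const 1ℤ) xs) ⟩
  (1ℤ + total (const 1ℤ) xs) * c ∎
  where
  step : ∀ c t → c + t * c ≡ (1ℤ + t) * c
  step = solve-∀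

-- The shape of a product of two 2 × 2 minors expanded along column zero: `p`, `q`, `r`, `s` are the
-- entries of that column, constant in the sum, and the functions are cofactors depending on the
-- other column.
total-bilinear : ∀ (p q r s : ℤ) (f g h k : A → ℤ) xs →
  total (λ x → (p * f x - q * g x) * (r * h x - s * k x)) xs ≡
    p * r * total (λ x → f x * h x) xs - p * s * total (λ x → f x * k x) xs
    - q * r * total (λ x → g x * h x) xs + q * s * total (λ x → g x * k x) xs
total-bilinear p q r s f g h k []       = base p q r s
  where
  base : ∀ p q r s → 0ℤ ≡ p * r * 0ℤ - p * s * 0ℤ - q * r * 0ℤ + q * s * 0ℤ
  base = solve-∀
total-bilinear p q r s f g h k (x ∷ xs) =
  trans (cong (λ y → term + y) (total-bilinear p q r s f g h k xs))
        (step p q r s (f x) (g x) (h x) (k x) _ _ _ _)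
  where
  term : ℤ
  term = (p * f x - q * g x) * (r * h x - s * k x)
  step : ∀ p q r s a b c d T U V W →
    (p * a - q * b) * (r * c - s * d)
      + (p * r * T - p * s * U - q * r * V + q * s * W) ≡
    p * r * (a * c + T) - p * s * (a * d + U) - q * r * (b * c + V) + q * s * (b * d + W)
  step = solve-∀

-- The corresponding shape for the square of a 3 × 3 minor expanded along column zero, with the
-- signs + - + of the cofactors.
total-square : ∀ (p q r : ℤ) (f g h : A → ℤ) xs →
  total (λ x → (p * f x - q * g x + r * h x) * (p * f x - q * g x + r * h x)) xs ≡
    p * p * total (λ x → f x * f x) xs + q * q * total (λ x → g x * g x) xs
    + r * r * total (λ x → h x * h x) xs
    + + 2 * (p * r * total (λ x → f x * h x) xs
      - p * q * total (λ x → f x * g x) xs - q * r * total (λ x → g x * h x) xs)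
total-square p q r f g h []       = base p q r
  where
  base : ∀ p q r → 0ℤ ≡ p * p * 0ℤ + q * q * 0ℤ + r * r * 0ℤ
                          + + 2 * (p * r * 0ℤ - p * q * 0ℤ - q * r * 0ℤ)
  base = solve-∀
total-square p q r f g h (x ∷ xs) =
  trans (cong (λ y → term + y) (total-square p q r f g h xs))
        (step p q r (f x) (g x) (h x) _ _ _ _ _ _)
  where
  term : ℤ
  term = (p * f x - q * g x + r * h x) * (p * f x - q * g x + r * h x)
  step : ∀ p q r a b c S T U V W X →
    (p * a - q * b + r * c) * (p * a - q * b + r * c)
      + (p * p * S + q * q * T + r * r * U + + 2 * (p * r * V - p * q * W - q * r * X)) ≡
    p * p * (a * a + S) + q * q * (b * b + T) + r * r * (c * c + U)
      + + 2 * (p * r * (a * c + V) - p * q * (a * b + W) - q * r * (b * c + X))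
  step = solve-∀

-- Number and distinctness of the choices

total-choices : ∀ m n (f : Vec (Fin (suc n)) (suc m) → ℤ) →
  total f (choices (suc m) (suc n)) ≡
    total (λ v → f (zero ∷ Vec.map suc v)) (choices m n)
    + total (f ∘ Vec.map suc) (choices (suc m) n)
total-choices m n f = trans
  (total-++ f (List.map (λ v → zero ∷ Vec.map suc v) (choices m n)) _)
  (cong₂ _+_ (total-map f _ (choices m n)) (total-map f _ (choices (suc m) n)))

-- The binomial coefficient n choose m, written as an integer total to match the factor produced by
-- `total-cartesianProductWith`.
∣choices_∣ : ℕ → ℕ → ℤ
∣choices m ∣ n = total (const 1ℤ) (choices m n)

∣choices₁∣ : ∀ n → ∣choices 1 ∣ n ≡ + n
∣choices₁∣ zero    = refl
∣choices₁∣ (suc n) =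
  trans (total-choices 0 n (const 1ℤ)) (cong (λ y → 1ℤ + y) (∣choices₁∣ n))

-- Induction by Pascal's rule, which is `total-choices` for the constant 1. The factor 2 avoids
-- division; for triples the factor is 6.
∣choices₂∣ : ∀ n → + 2 * ∣choices 2 ∣ n ≡ + n * (+ n - + 1)
∣choices₂∣ zero    = refl
∣choices₂∣ (suc n) = begin
  + 2 * ∣choices 2 ∣ (suc n)
    ≡⟨ cong (+ 2 *_) (total-choices 1 n (const 1ℤ)) ⟩
  + 2 * (∣choices 1 ∣ n + ∣choices 2 ∣ n)
    ≡⟨ ℤ.*-distribˡ-+ (+ 2) (∣choices 1 ∣ n) (∣choices 2 ∣ n) ⟩
  + 2 * ∣choices 1 ∣ n + + 2 * ∣choices 2 ∣ n
    ≡⟨ cong₂ (λ x y → + 2 * x + y) (∣choices₁∣ n) (∣choices₂∣ n) ⟩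
  + 2 * + n + + n * (+ n - + 1)
    ≡⟨ step (+ n) ⟩
  (1ℤ + + n) * (1ℤ + + n - + 1) ∎
  where
  step : ∀ x → + 2 * x + x * (x - + 1) ≡ (1ℤ + x) * (1ℤ + x - + 1)
  step = solve-∀

∣choices₃∣ : ∀ n → + 6 * ∣choices 3 ∣ n ≡ + n * (+ n - + 1) * (+ n - + 2)
∣choices₃∣ zero    = refl
∣choices₃∣ (suc n) = begin
  + 6 * ∣choices 3 ∣ (suc n)
    ≡⟨ cong (+ 6 *_) (total-choices 2 n (const 1ℤ)) ⟩
  + 6 * (∣choices 2 ∣ n + ∣choices 3 ∣ n)
    ≡⟨ distrib (∣choices 2 ∣ n) (∣choices 3 ∣ n) ⟩
  + 3 * (+ 2 * ∣choices 2 ∣ n) + + 6 * ∣choices 3 ∣ n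
    ≡⟨ cong₂ (λ x y → + 3 * x + y) (∣choices₂∣ n) (∣choices₃∣ n) ⟩
  + 3 * (+ n * (+ n - + 1)) + + n * (+ n - + 1) * (+ n - + 2)
    ≡⟨ step (+ n) ⟩
  (1ℤ + + n) * (1ℤ + + n - + 1) * (1ℤ + + n - + 2) ∎
  where
  distrib : ∀ x y → + 6 * (x + y) ≡ + 3 * (+ 2 * x) + + 6 * y
  distrib = solve-∀
  step : ∀ x → + 3 * (x * (x - + 1)) + x * (x - + 1) * (x - + 2) ≡
               (1ℤ + x) * (1ℤ + x - + 1) * (1ℤ + x - + 2)
  step = solve-∀

-- Provides the distinctness of the chosen rows, on which their pairwise orthogonality depends.
choices-unique : ∀ m n → All Unique (choices m n)
choices-unique zero    n       = [] ∷ []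
choices-unique (suc m) zero    = []
choices-unique (suc m) (suc n) = ++⁺
  -- The new head `zero` differs from every successor, and injectivity of `suc` keeps the tail
  -- distinct.
  (map⁺ (All.map (λ u → VecAll.map⁺ (VecAll.universal (λ _ ()) _) ∷ map-suc u)
                 (choices-unique m n)))
  (map⁺ (All.map map-suc (choices-unique (suc m) n)))
  where
  map-suc : ∀ {k} {v : Vec (Fin n) k} → Unique v → Unique (Vec.map suc v)
  map-suc = Unique.map⁺ Fin.suc-injective

-- Determinants of order 2 and 3

det₂ : (a b c d : ℤ) → ℤ
det₂ a b c d = a * d - b * c

det₃ : (a b c d e f g h i : ℤ) → ℤ
det₃ a b c d e f g h i = a * det₂ e f h i - b * det₂ d f g i + c * det₂ d e g h

-- Here and for orders 2 and 3, the rows are separate vectors, so that composing each of them with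
-- `suc` deletes column zero in the inductions on the number of columns.
minor₁ : Vector ℤ n → Vec (Fin n) 1 → ℤ
minor₁ a (j ∷ []) = a j

minor₂ : (a b : Vector ℤ n) → Vec (Fin n) 2 → ℤ
minor₂ a b (j ∷ k ∷ []) = det₂ (a j) (a k) (b j) (b k)

minor₃ : (a b c : Vector ℤ n) → Vec (Fin n) 3 → ℤ
minor₃ a b c (j ∷ k ∷ l ∷ []) =
  det₃ (a j) (a k) (a l) (b j) (b k) (b l) (c j) (c k) (c l)

det≡det₂ : (M : Matrix 2 2) →
  det M ≡ det₂ (M 0F 0F) (M 0F 1F) (M 1F 0F) (M 1F 1F)
det≡det₂ M = laplace (M 0F 0F) (M 0F 1F) _ _
  where
  -- The left side is `det` unfolded: the powers of -1 are evaluated, each `1ℤ` on the right of a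
  -- product is the empty determinant, and each `0ℤ` closes a sum.
  laplace : ∀ a b c d → 1ℤ * a * (1ℤ * d * 1ℤ + 0ℤ) + (-1ℤ * b * (1ℤ * c * 1ℤ + 0ℤ) + 0ℤ) ≡
            a * d - b * c
  laplace = solve-∀

det≡det₃ : (M : Matrix 3 3) →
  det M ≡ det₃ (M 0F 0F) (M 0F 1F) (M 0F 2F)
               (M 1F 0F) (M 1F 1F) (M 1F 2F)
               (M 2F 0F) (M 2F 1F) (M 2F 2F)
det≡det₃ M = trans
  (laplace (M 0F 0F) (M 0F 1F) (M 0F 2F) _ _ _)
  (cong₂ _+_ (cong₂ _-_ (cong₂ _*_ {x = M 0F 0F} refl (det≡det₂ (minor 0F)))
                        (cong₂ _*_ {x = M 0F 1F} refl (det≡det₂ (minor 1F))))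
             (cong₂ _*_ {x = M 0F 2F} refl (det≡det₂ (minor 2F))))
  where
  minor : Fin 3 → Matrix 2 2
  minor j i = removeAt (M (suc i)) j
  laplace : ∀ a b c x y z → 1ℤ * a * x + (-1ℤ * b * y + (1ℤ * c * z + 0ℤ)) ≡
            a * x - b * y + c * z
  laplace = solve-∀

-- Cauchy–Binet

infix 8 _·_

_·_ : (a b : Vector ℤ n) → ℤ
a · b = sum (λ k → a k * b k)

·-comm : (a b : Vector ℤ n) → a · b ≡ b · a
·-comm a b = sum-cong-≗ (λ k → ℤ.*-comm (a k) (b k))

cauchyBinet₁ : ∀ n (a b : Vector ℤ n) →
  total (λ v → minor₁ a v * minor₁ b v) (choices 1 n) ≡ a · b
cauchyBinet₁ zero    a b = refl
cauchyBinet₁ (suc n) a b = trans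
  (total-choices 0 n (λ v → minor₁ a v * minor₁ b v))
  (cong₂ _+_ (ℤ.+-identityʳ (a zero * b zero))
    (trans (total-cong shift (choices 1 n)) (cauchyBinet₁ n (a ∘ suc) (b ∘ suc))))
  where
  shift : ∀ v → minor₁ a (Vec.map suc v) * minor₁ b (Vec.map suc v) ≡
                minor₁ (a ∘ suc) v * minor₁ (b ∘ suc) v
  shift (_ ∷ []) = refl

-- Stated for two pairs of rows because expanding the squares in cauchyBinet₃
-- along column 0 produces mixed products of 2 × 2 minors.
cauchyBinet₂ : ∀ n (a b c d : Vector ℤ n) →
  total (λ v → minor₂ a b v * minor₂ c d v) (choices 2 n) ≡
    det₂ (a · c) (a · d) (b · c) (b · d)
cauchyBinet₂ zero    a b c d = refl
cauchyBinet₂ (suc n) a b c d = begin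
  total (λ v → minor₂ a b v * minor₂ c d v) (choices 2 (suc n))
    ≡⟨ total-choices 1 n (λ v → minor₂ a b v * minor₂ c d v) ⟩
  total (λ v → minor₂ a b (zero ∷ Vec.map suc v) * minor₂ c d (zero ∷ Vec.map suc v))
        (choices 1 n)
    + total (λ v → minor₂ a b (Vec.map suc v) * minor₂ c d (Vec.map suc v)) (choices 2 n)
    -- Minors using column zero are expanded along it; the others are minors of the shortened rows.
    ≡⟨ cong₂ _+_ (total-cong firstColumn (choices 1 n))
                 (total-cong shift (choices 2 n)) ⟩
  total (λ v → (a zero * minor₁ b′ v - b zero * minor₁ a′ v)
             * (c zero * minor₁ d′ v - d zero * minor₁ c′ v)) (choices 1 n)
    + total (λ v → minor₂ a′ b′ v * minor₂ c′ d′ v) (choices 2 n)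
    ≡⟨ cong₂ _+_ (total-bilinear (a zero) (b zero) (c zero) (d zero)
                   (minor₁ b′) (minor₁ a′) (minor₁ d′) (minor₁ c′) (choices 1 n))
                 (cauchyBinet₂ n a′ b′ c′ d′) ⟩
  a zero * c zero * T b′ d′ - a zero * d zero * T b′ c′
    - b zero * c zero * T a′ d′ + b zero * d zero * T a′ c′
    + det₂ (a′ · c′) (a′ · d′) (b′ · c′) (b′ · d′)
    ≡⟨ combine (cauchyBinet₁ n b′ d′) (cauchyBinet₁ n b′ c′)
               (cauchyBinet₁ n a′ d′) (cauchyBinet₁ n a′ c′) ⟩
  a zero * c zero * b′ · d′ - a zero * d zero * b′ · c′
    - b zero * c zero * a′ · d′ + b zero * d zero * a′ · c′
    + det₂ (a′ · c′) (a′ · d′) (b′ · c′) (b′ · d′)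
    ≡⟨ step (a zero) (b zero) (c zero) (d zero) (a′ · c′) (a′ · d′) (b′ · c′) (b′ · d′) ⟩
  det₂ (a · c) (a · d) (b · c) (b · d) ∎
  where
  a′ b′ c′ d′ : Vector ℤ n
  a′ = a ∘ suc
  b′ = b ∘ suc
  c′ = c ∘ suc
  d′ = d ∘ suc
  T : (x y : Vector ℤ n) → ℤ
  T x y = total (λ v → minor₁ x v * minor₁ y v) (choices 1 n)
  combine : ∀ {x x′ y y′ z z′ w w′} → x ≡ x′ → y ≡ y′ → z ≡ z′ → w ≡ w′ →
    a zero * c zero * x - a zero * d zero * y - b zero * c zero * z + b zero * d zero * w
      + det₂ (a′ · c′) (a′ · d′) (b′ · c′) (b′ · d′) ≡
    a zero * c zero * x′ - a zero * d zero * y′ - b zero * c zero * z′ + b zero * d zero * w′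
      + det₂ (a′ · c′) (a′ · d′) (b′ · c′) (b′ · d′)
  combine refl refl refl refl = refl
  firstColumn : ∀ v →
    minor₂ a b (zero ∷ Vec.map suc v) * minor₂ c d (zero ∷ Vec.map suc v) ≡
    (a zero * minor₁ b′ v - b zero * minor₁ a′ v)
      * (c zero * minor₁ d′ v - d zero * minor₁ c′ v)
  firstColumn (j ∷ []) =
    flip (a zero) (b zero) (c zero) (d zero) (a′ j) (b′ j) (c′ j) (d′ j)
    where
    flip : ∀ a b c d a′ b′ c′ d′ →
      (a * b′ - a′ * b) * (c * d′ - c′ * d) ≡ (a * b′ - b * a′) * (c * d′ - d * c′)
    flip = solve-∀
  shift : ∀ v → minor₂ a b (Vec.map suc v) * minor₂ c d (Vec.map suc v) ≡
                minor₂ a′ b′ v * minor₂ c′ d′ v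
  shift (_ ∷ _ ∷ []) = refl
  -- Restoring column zero adds the rank-one matrix with entries `a * c`, `a * d`, `b * c`, `b * d`
  -- to the matrix of inner products; the determinant changes by a form in the adjugate of the old
  -- matrix.
  step : ∀ a b c d ac ad bc bd →
    a * c * bd - a * d * bc - b * c * ad + b * d * ac + (ac * bd - ad * bc) ≡
    (a * c + ac) * (b * d + bd) - (a * d + ad) * (b * c + bc)
  step = solve-∀

-- The Gram matrix is symmetric; only its upper triangle appears here.
gram₃ : (aa ab ac bb bc cc : ℤ) → ℤ
gram₃ aa ab ac bb bc cc = det₃ aa ab ac ab bb bc ac bc cc

-- Induction on the number of columns. Squares of minors using column zero expand into products of 2
-- × 2 minors of the shortened rows, summed by `cauchyBinet₂`; the remaining choices are the
-- induction hypothesis.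
cauchyBinet₃ : ∀ n (a b c : Vector ℤ n) →
  total (λ v → minor₃ a b c v * minor₃ a b c v) (choices 3 n) ≡
    gram₃ (a · a) (a · b) (a · c) (b · b) (b · c) (c · c)
cauchyBinet₃ zero    a b c = refl
cauchyBinet₃ (suc n) a b c = begin
  total (λ v → minor₃ a b c v * minor₃ a b c v) (choices 3 (suc n))
    ≡⟨ total-choices 2 n (λ v → minor₃ a b c v * minor₃ a b c v) ⟩
  total (λ v → minor₃ a b c (zero ∷ Vec.map suc v) * minor₃ a b c (zero ∷ Vec.map suc v))
        (choices 2 n)
    + total (λ v → minor₃ a b c (Vec.map suc v) * minor₃ a b c (Vec.map suc v)) (choices 3 n)
    ≡⟨ cong₂ _+_ (total-cong (λ v → cong₂ _*_ (firstColumn v) (firstColumn v)) (choices 2 n))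
                 (total-cong shift (choices 3 n)) ⟩
  total (λ v → expansion v * expansion v) (choices 2 n)
    + total (λ v → minor₃ a′ b′ c′ v * minor₃ a′ b′ c′ v) (choices 3 n)
    ≡⟨ cong₂ _+_ (total-square (a zero) (b zero) (c zero)
                   (minor₂ b′ c′) (minor₂ a′ c′) (minor₂ a′ b′) (choices 2 n))
                 (cauchyBinet₃ n a′ b′ c′) ⟩
  a zero * a zero * T b′ c′ b′ c′ + b zero * b zero * T a′ c′ a′ c′
    + c zero * c zero * T a′ b′ a′ b′
    + + 2 * (a zero * c zero * T b′ c′ a′ b′
      - a zero * b zero * T b′ c′ a′ c′ - b zero * c zero * T a′ c′ a′ b′)
    + gram₃ aa ab ac bb bc cc
    -- Commutativity moves every inner product into the upper triangle of the Gram matrix.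
    ≡⟨ combine (T≡ refl refl (·-comm c′ b′) refl) (T≡ refl refl (·-comm c′ a′) refl)
               (T≡ refl refl (·-comm b′ a′) refl)
               (T≡ (·-comm b′ a′) refl (·-comm c′ a′) (·-comm c′ b′))
               (T≡ (·-comm b′ a′) refl (·-comm c′ a′) refl)
               (T≡ refl refl (·-comm c′ a′) (·-comm c′ b′)) ⟩
  a zero * a zero * det₂ bb bc bc cc + b zero * b zero * det₂ aa ac ac cc
    + c zero * c zero * det₂ aa ab ab bb
    + + 2 * (a zero * c zero * det₂ ab bb ac bc
      - a zero * b zero * det₂ ab bc ac cc - b zero * c zero * det₂ aa ab ac bc)
    + gram₃ aa ab ac bb bc cc
    ≡⟨ step (a zero) (b zero) (c zero) aa ab ac bb bc cc ⟩
  gram₃ (a · a) (a · b) (a · c) (b · b) (b · c) (c · c) ∎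
  where
  a′ b′ c′ : Vector ℤ n
  a′ = a ∘ suc
  b′ = b ∘ suc
  c′ = c ∘ suc
  aa ab ac bb bc cc : ℤ
  aa = a′ · a′
  ab = a′ · b′
  ac = a′ · c′
  bb = b′ · b′
  bc = b′ · c′
  cc = c′ · c′
  T : (x y z w : Vector ℤ n) → ℤ
  T x y z w = total (λ v → minor₂ x y v * minor₂ z w v) (choices 2 n)
  T≡ : ∀ {x y z w p q r s} → x · z ≡ p → x · w ≡ q → y · z ≡ r → y · w ≡ s →
       T x y z w ≡ det₂ p q r s
  T≡ {x} {y} {z} {w} refl refl refl refl = cauchyBinet₂ n x y z w
  expansion : Vec (Fin n) 2 → ℤ
  expansion v = a zero * minor₂ b′ c′ v - b zero * minor₂ a′ c′ v + c zero * minor₂ a′ b′ v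
  firstColumn : ∀ v → minor₃ a b c (zero ∷ Vec.map suc v) ≡ expansion v
  firstColumn (j ∷ k ∷ []) =
    identity (a zero) (a′ j) (a′ k) (b zero) (b′ j) (b′ k) (c zero) (c′ j) (c′ k)
    where
    -- Expansion along the first row on the left, as in `det₃`, and along column zero on the right.
    identity : ∀ a a′ a″ b b′ b″ c c′ c″ →
      a * (b′ * c″ - b″ * c′) - a′ * (b * c″ - b″ * c) + a″ * (b * c′ - b′ * c) ≡
      a * (b′ * c″ - b″ * c′) - b * (a′ * c″ - a″ * c′) + c * (a′ * b″ - a″ * b′)
    identity = solve-∀
  shift : ∀ v → minor₃ a b c (Vec.map suc v) * minor₃ a b c (Vec.map suc v) ≡
                minor₃ a′ b′ c′ v * minor₃ a′ b′ c′ v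
  shift (_ ∷ _ ∷ _ ∷ []) = refl
  combine : ∀ {x x′ y y′ z z′ w w′ v v′ k k′} →
    x ≡ x′ → y ≡ y′ → z ≡ z′ → w ≡ w′ → v ≡ v′ → k ≡ k′ →
    a zero * a zero * x + b zero * b zero * y + c zero * c zero * z
      + + 2 * (a zero * c zero * w - a zero * b zero * v - b zero * c zero * k)
      + gram₃ aa ab ac bb bc cc ≡
    a zero * a zero * x′ + b zero * b zero * y′ + c zero * c zero * z′
      + + 2 * (a zero * c zero * w′ - a zero * b zero * v′ - b zero * c zero * k′)
      + gram₃ aa ab ac bb bc cc
  combine refl refl refl refl refl refl = refl
  -- The matrix determinant lemma: for u = (a, b, c) and G the old Gram matrix, det (G + u uᵀ) = det
  -- G + uᵀ adj(G) u.
  step : ∀ a b c aa ab ac bb bc cc →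
    a * a * (bb * cc - bc * bc) + b * b * (aa * cc - ac * ac) + c * c * (aa * bb - ab * ab)
      + + 2 * (a * c * (ab * bc - bb * ac) - a * b * (ab * cc - bc * ac)
               - b * c * (aa * bc - ab * ac))
      + (aa * (bb * cc - bc * bc) - ab * (ab * cc - bc * ac) + ac * (ab * bc - bb * ac)) ≡
    (a * a + aa) * ((b * b + bb) * (c * c + cc) - (b * c + bc) * (b * c + bc))
      - (a * b + ab) * ((a * b + ab) * (c * c + cc) - (b * c + bc) * (a * c + ac))
      + (a * c + ac) * ((a * b + ab) * (b * c + bc) - (b * b + bb) * (a * c + ac))
  step = solve-∀

-- Signed entries

IsSign : ℤ → Set
IsSign x = x ≡ 1ℤ ⊎ x ≡ -1ℤ

-- A sign has two values, so testing both decides the statement. Nested once per matrix entry, it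
-- turns claims about all sign matrices of a fixed size into a finite evaluation.
allSigns? : {P : ℤ → Set} → Decidable P → Dec (∀ {x} → IsSign x → P x)
allSigns? P? = map′
  (λ { (p , q) (inj₁ refl) → p ; (p , q) (inj₂ refl) → q })
  (λ f → f (inj₁ refl) , f (inj₂ refl))
  (P? 1ℤ ×-dec P? -1ℤ)

-- Records the square of a non-zero minor instead of its absolute value, since sums of squares are
-- what Cauchy-Binet supplies.
ZeroOrSquare : ℤ → ℤ → Set
ZeroOrSquare K x = x ≡ 0ℤ ⊎ x * x ≡ K

zeroOrSquare? : ∀ K → Decidable (ZeroOrSquare K)
zeroOrSquare? K x = x ℤ.≟ 0ℤ ⊎-dec x * x ℤ.≟ K

det₂-signs : ∀ {a} → IsSign a → ∀ {b} → IsSign b →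
             ∀ {c} → IsSign c → ∀ {d} → IsSign d → ZeroOrSquare (+ 4) (det₂ a b c d)
det₂-signs = toWitness
  {a? = allSigns? λ a → allSigns? λ b → allSigns? λ c → allSigns? λ d →
        zeroOrSquare? (+ 4) (det₂ a b c d)} _

-- Evaluation of all 512 sign patterns.
det₃-signs : ∀ {a} → IsSign a → ∀ {b} → IsSign b → ∀ {c} → IsSign c →
             ∀ {d} → IsSign d → ∀ {e} → IsSign e → ∀ {f} → IsSign f →
             ∀ {g} → IsSign g → ∀ {h} → IsSign h → ∀ {i} → IsSign i →
             ZeroOrSquare (+ 16) (det₃ a b c d e f g h i)
det₃-signs = toWitness
  {a? = allSigns? λ a → allSigns? λ b → allSigns? λ c →
        allSigns? λ d → allSigns? λ e → allSigns? λ f →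
        allSigns? λ g → allSigns? λ h → allSigns? λ i →
        zeroOrSquare? (+ 16) (det₃ a b c d e f g h i)} _

det-signs₂ : (M : Matrix 2 2) → (∀ i j → IsSign (M i j)) → ZeroOrSquare (+ 4) (det M)
det-signs₂ M s = subst (ZeroOrSquare (+ 4)) (sym (det≡det₂ M))
  (det₂-signs (s 0F 0F) (s 0F 1F) (s 1F 0F) (s 1F 1F))

det-signs₃ : (M : Matrix 3 3) → (∀ i j → IsSign (M i j)) → ZeroOrSquare (+ 16) (det M)
det-signs₃ M s = subst (ZeroOrSquare (+ 16)) (sym (det≡det₃ M))
  (det₃-signs (s 0F 0F) (s 0F 1F) (s 0F 2F)
              (s 1F 0F) (s 1F 1F) (s 1F 2F)
              (s 2F 0F) (s 2F 1F) (s 2F 2F))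

-- Counting zero minors through sums of squares

square : ℤ → ℤ
square x = x * x

zeros : List ℤ → ℕ
zeros = length ∘ filter (ℤ._≟ 0ℤ)

-- Each entry contributes exactly `K`: a zero through the count, weighted by `K`, and a non-zero
-- entry through its square.
zeros-∷ : ∀ K {x} xs → ZeroOrSquare K x →
  K * + zeros (x ∷ xs) + square x ≡ K + K * + zeros xs
zeros-∷ K {x} xs p with x ℤ.≟ 0ℤ | p
... | yes refl | _         = trans (ℤ.+-identityʳ _) (ℤ.*-suc K (+ zeros xs))
... | no x≢0   | inj₁ x≡0  = contradiction x≡0 x≢0
... | no _     | inj₂ refl = ℤ.+-comm (K * + zeros xs) K

zeros+squares : ∀ K {xs} → All (ZeroOrSquare K) xs →
  K * + zeros xs + total square xs ≡ K * total (const 1ℤ) xs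
zeros+squares K []                = ℤ.+-identityʳ (K * 0ℤ)
zeros+squares K {x ∷ xs} (p ∷ ps) = begin
  K * + zeros (x ∷ xs) + (square x + total square xs)
    ≡⟨ ℤ.+-assoc (K * + zeros (x ∷ xs)) (square x) _ ⟨
  K * + zeros (x ∷ xs) + square x + total square xs
    ≡⟨ cong (λ y → y + total square xs) (zeros-∷ K xs p) ⟩
  K + K * + zeros xs + total square xs
    ≡⟨ ℤ.+-assoc K (K * + zeros xs) _ ⟩
  K + (K * + zeros xs + total square xs)
    ≡⟨ cong (λ y → K + y) (zeros+squares K ps) ⟩
  K + K * total (const 1ℤ) xs
    ≡⟨ ℤ.*-suc K (total (const 1ℤ) xs) ⟨
  K * (1ℤ + total (const 1ℤ) xs) ∎

-- For L choices of m indices there are L² minors, each contributing `K`, and the squares sum to `c`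
-- over each of the L row choices.
Z-count : ∀ K c m {n} (H : Matrix n n) →
  (∀ rows cols → ZeroOrSquare K (det (submatrix H rows cols))) →
  (∀ {rows} → Unique rows →
    total (λ cols → square (det (submatrix H rows cols))) (choices m n) ≡ c) →
  K * + Z m H + ∣choices m ∣ n * c ≡ K * (∣choices m ∣ n * ∣choices m ∣ n)
Z-count K c m {n} H zs eq = begin
  K * + Z m H + ∣choices m ∣ n * c
    ≡⟨ cong (λ y → K * + Z m H + y) (total-cartesianProductWith square minor (choices m n) c
         (All.map eq (choices-unique m n))) ⟨
  K * + Z m H + total square (minors m H)
    ≡⟨ zeros+squares K (cartesianProductWith⁺ (setoid Choice) (setoid Choice) minor
         (choices m n) (choices m n) (λ {rows} {cols} _ _ → zs rows cols)) ⟩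
  K * total (const 1ℤ) (minors m H)
    ≡⟨ cong (K *_) (total-cartesianProductWith (const 1ℤ) minor (choices m n) _
         (All.universal (λ _ → refl) (choices m n))) ⟩
  K * (∣choices m ∣ n * ∣choices m ∣ n) ∎
  where
  Choice : Set
  Choice = Vec (Fin n) m
  minor : Choice → Choice → ℤ
  minor rows cols = det (submatrix H rows cols)

-- Unnormalised fractions are equal by cross-multiplication, and normalisation respects that
-- equality.
/1≡/ : ∀ (z p : ℤ) d → z * + suc d ≡ p → z / 1 ≡ p / suc d
/1≡/ z p d eq =
  fromℚᵘ-cong {mkℚᵘ z 0} {mkℚᵘ p d} (*≡* (trans eq (sym (ℤ.*-identityʳ p))))

-- Gram determinants of Hadamard rows and the closed formulas

module _ {n : ℕ} {H : Matrix n n} (isHadamard : IsHadamard H) where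
  open IsHadamard isHadamard

  row·itself : ∀ i → H i · H i ≡ + n
  -- Abstracting the decision inside `𝕀` together with the orthogonality equation makes the identity
  -- entry compute.
  row·itself i with i Fin.≟ i | orthogonal i i
  ... | yes _  | eq = trans eq (ℤ.*-identityʳ (+ n))
  ... | no i≢i | _  = contradiction refl i≢i

  row·other : ∀ {i j} → i ≢ j → H i · H j ≡ 0ℤ
  row·other {i} {j} i≢j with i Fin.≟ j | orthogonal i j
  ... | yes i≡j | _  = contradiction i≡j i≢j
  ... | no _    | eq = trans eq (ℤ.*-zeroʳ (+ n))

  submatrix-signs : ∀ {k l} (rows : Vec (Fin n) k) (cols : Vec (Fin n) l) →
    ∀ i j → IsSign (submatrix H rows cols i j)
  submatrix-signs rows cols i j = entries (Vec.lookup rows i) (Vec.lookup cols j)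

  minors₂-squares : ∀ {rows : Vec (Fin n) 2} → Unique rows →
    total (λ cols → square (det (submatrix H rows cols))) (choices 2 n) ≡ (+ n) ^ 2
  minors₂-squares {r ∷ s ∷ []} ((r≢s ∷ []) ∷ _) = begin
    total (λ cols → square (det (submatrix H (r ∷ s ∷ []) cols))) (choices 2 n)
      ≡⟨ total-cong (λ { v@(_ ∷ _ ∷ []) → cong square (det≡det₂ (submatrix H (r ∷ s ∷ []) v)) })
                    (choices 2 n) ⟩
    total (λ v → minor₂ (H r) (H s) v * minor₂ (H r) (H s) v) (choices 2 n)
      ≡⟨ cauchyBinet₂ n (H r) (H s) (H r) (H s) ⟩
    det₂ (H r · H r) (H r · H s) (H s · H r) (H s · H s)
      -- `H s · H r` is carried along unevaluated; its cofactor `H r · H s` has become zero.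
      ≡⟨ gram (row·itself r) (row·other r≢s) (row·itself s) ⟩
    det₂ (+ n) 0ℤ (H s · H r) (+ n)
      ≡⟨ simplify (+ n) (H s · H r) ⟩
    (+ n) ^ 2 ∎
    where
    gram : ∀ {p q r p′ q′ s s′} → p ≡ p′ → q ≡ q′ → s ≡ s′ → det₂ p q r s ≡ det₂ p′ q′ r s′
    gram refl refl refl = refl
    simplify : ∀ x y → x * x - 0ℤ * y ≡ x * (x * 1ℤ)
    simplify = solve-∀

  minors₃-squares : ∀ {rows : Vec (Fin n) 3} → Unique rows →
    total (λ cols → square (det (submatrix H rows cols))) (choices 3 n) ≡ (+ n) ^ 3
  minors₃-squares {r ∷ s ∷ t ∷ []} ((r≢s ∷ r≢t ∷ []) ∷ (s≢t ∷ []) ∷ _) = begin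
    total (λ cols → square (det (submatrix H (r ∷ s ∷ t ∷ []) cols))) (choices 3 n)
      ≡⟨ total-cong (λ { v@(_ ∷ _ ∷ _ ∷ []) → cong square (det≡det₃ (submatrix H (r ∷ s ∷ t ∷ []) v)) })
                    (choices 3 n) ⟩
    total (λ v → minor₃ (H r) (H s) (H t) v * minor₃ (H r) (H s) (H t) v) (choices 3 n)
      ≡⟨ cauchyBinet₃ n (H r) (H s) (H t) ⟩
    gram₃ (H r · H r) (H r · H s) (H r · H t) (H s · H s) (H s · H t) (H t · H t)
      ≡⟨ gram (row·itself r) (row·other r≢s) (row·other r≢t)
              (row·itself s) (row·other s≢t) (row·itself t) ⟩
    gram₃ (+ n) 0ℤ 0ℤ (+ n) 0ℤ (+ n)
      ≡⟨ simplify (+ n) ⟩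
    (+ n) ^ 3 ∎
    where
    gram : ∀ {a b c d e f a′ b′ c′ d′ e′ f′} →
      a ≡ a′ → b ≡ b′ → c ≡ c′ → d ≡ d′ → e ≡ e′ → f ≡ f′ →
      gram₃ a b c d e f ≡ gram₃ a′ b′ c′ d′ e′ f′
    gram refl refl refl refl refl refl = refl
    simplify : ∀ x → x * (x * x - 0ℤ * 0ℤ) - 0ℤ * (0ℤ * x - 0ℤ * 0ℤ) + 0ℤ * (0ℤ * 0ℤ - x * 0ℤ) ≡
               x * (x * (x * 1ℤ))
    simplify = solve-∀

  -- `Z-count` reads 4 Z + L n² = 4 L². After scaling, L enters only through 2 L, the polynomial
  -- given by `∣choices₂∣`; the common factor 2 is cancelled.
  Z₂ : + Z 2 H * + 8 ≡ (+ n) ^ 2 * (+ n - + 1) * (+ n - + 2)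
  Z₂ = ℤ.*-cancelˡ-≡ (+ 2) _ _ (begin
    + 2 * (+ Z 2 H * + 8)
      ≡⟨ expand (+ Z 2 H) L (+ n) ⟩
    + 4 * (+ 4 * + Z 2 H + L * (+ n) ^ 2) - + 2 * (+ 2 * L) * (+ n) ^ 2
      ≡⟨ cong (λ x → + 4 * x - + 2 * (+ 2 * L) * (+ n) ^ 2)
           (Z-count (+ 4) ((+ n) ^ 2) 2 H
             (λ rows cols → det-signs₂ (submatrix H rows cols) (submatrix-signs rows cols))
             minors₂-squares) ⟩
    + 4 * (+ 4 * (L * L)) - + 2 * (+ 2 * L) * (+ n) ^ 2
      ≡⟨ regroup L (+ n) ⟩
    + 4 * ((+ 2 * L) * (+ 2 * L)) - + 2 * (+ 2 * L) * (+ n) ^ 2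
      ≡⟨ cong (λ x → + 4 * (x * x) - + 2 * x * (+ n) ^ 2) (∣choices₂∣ n) ⟩
    + 4 * (q (+ n) * q (+ n)) - + 2 * q (+ n) * (+ n) ^ 2
      ≡⟨ factor (+ n) ⟩
    + 2 * ((+ n) ^ 2 * (+ n - + 1) * (+ n - + 2)) ∎)
    where
    L = ∣choices 2 ∣ n
    q : ℤ → ℤ
    q x = x * (x - + 1)
    expand : ∀ z l x → + 2 * (z * + 8) ≡
      + 4 * (+ 4 * z + l * (x * (x * 1ℤ))) - + 2 * (+ 2 * l) * (x * (x * 1ℤ))
    expand = solve-∀
    regroup : ∀ l x → + 4 * (+ 4 * (l * l)) - + 2 * (+ 2 * l) * (x * (x * 1ℤ)) ≡
      + 4 * ((+ 2 * l) * (+ 2 * l)) - + 2 * (+ 2 * l) * (x * (x * 1ℤ))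
    regroup = solve-∀
    -- The last factor arises as 2 (x - 1) - x = x - 2.
    factor : ∀ x → + 4 * (x * (x - + 1) * (x * (x - + 1))) - + 2 * (x * (x - + 1)) * (x * (x * 1ℤ)) ≡
      + 2 * (x * (x * 1ℤ) * (x - + 1) * (x - + 2))
    factor = solve-∀

  -- Same scheme from 16 Z + L n³ = 16 L²: multiplying by 36 lets L enter only through 6 L, and 36 ·
  -- 16 = 2 · 288.
  Z₃ : + Z 3 H * + 288 ≡
       (+ n) ^ 2 * (+ n - + 1) * (+ n - + 2) * (+ n - + 4) * (+ 5 * + n - + 4)
  Z₃ = ℤ.*-cancelˡ-≡ (+ 2) _ _ (begin
    + 2 * (+ Z 3 H * + 288)
      ≡⟨ expand (+ Z 3 H) L (+ n) ⟩
    + 36 * (+ 16 * + Z 3 H + L * (+ n) ^ 3) - + 6 * (+ 6 * L) * (+ n) ^ 3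
      ≡⟨ cong (λ x → + 36 * x - + 6 * (+ 6 * L) * (+ n) ^ 3)
           (Z-count (+ 16) ((+ n) ^ 3) 3 H
             (λ rows cols → det-signs₃ (submatrix H rows cols) (submatrix-signs rows cols))
             minors₃-squares) ⟩
    + 36 * (+ 16 * (L * L)) - + 6 * (+ 6 * L) * (+ n) ^ 3
      ≡⟨ regroup L (+ n) ⟩
    + 16 * ((+ 6 * L) * (+ 6 * L)) - + 6 * (+ 6 * L) * (+ n) ^ 3
      ≡⟨ cong (λ x → + 16 * (x * x) - + 6 * x * (+ n) ^ 3) (∣choices₃∣ n) ⟩
    + 16 * (q (+ n) * q (+ n)) - + 6 * q (+ n) * (+ n) ^ 3
      ≡⟨ factor (+ n) ⟩
    + 2 * ((+ n) ^ 2 * (+ n - + 1) * (+ n - + 2) * (+ n - + 4) * (+ 5 * + n - + 4)) ∎)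
    where
    L = ∣choices 3 ∣ n
    q : ℤ → ℤ
    q x = x * (x - + 1) * (x - + 2)
    expand : ∀ z l x → + 2 * (z * + 288) ≡
      + 36 * (+ 16 * z + l * (x * (x * (x * 1ℤ)))) - + 6 * (+ 6 * l) * (x * (x * (x * 1ℤ)))
    expand = solve-∀
    regroup : ∀ l x → + 36 * (+ 16 * (l * l)) - + 6 * (+ 6 * l) * (x * (x * (x * 1ℤ))) ≡
      + 16 * ((+ 6 * l) * (+ 6 * l)) - + 6 * (+ 6 * l) * (x * (x * (x * 1ℤ)))
    regroup = solve-∀
    -- The last two factors come from 8 (x - 1) (x - 2) - 3 x² = 5 x² - 24 x + 16 = (x - 4) (5 x -
    -- 4).
    factor : ∀ x →
      + 16 * (x * (x - + 1) * (x - + 2) * (x * (x - + 1) * (x - + 2)))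
        - + 6 * (x * (x - + 1) * (x - + 2)) * (x * (x * (x * 1ℤ))) ≡
      + 2 * (x * (x * 1ℤ) * (x - + 1) * (x - + 2) * (x - + 4) * (+ 5 * x - + 4))
    factor = solve-∀

corollary4 : (n : ℕ) (H : Matrix n n) → IsHadamard H →
    (+ Z 2 H / 1 ≡ ((+ n) ^ 2 * (+ n - + 1) * (+ n - + 2)) / 8)
    × (+ Z 3 H / 1 ≡ ((+ n) ^ 2 * (+ n - + 1) * (+ n - + 2) * (+ n - + 4) * (+ 5 * + n - + 4)) / 288)
corollary4 n H isHadamard =
  -- `/1≡/` takes the predecessor of the denominator: 7 for 8 and 287 for 288.
  /1≡/ (+ Z 2 H) ((+ n) ^ 2 * (+ n - + 1) * (+ n - + 2)) 7 (Z₂ isHadamard) ,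
  /1≡/ (+ Z 3 H) ((+ n) ^ 2 * (+ n - + 1) * (+ n - + 2) * (+ n - + 4) * (+ 5 * + n - + 4)) 287
    (Z₃ isHadamard)
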